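{- The optimum dimension of the Weisfeiler-Lehman algorithm on graphs of order $n$ satisfies $\mathrm{WL}(n)\le (n+1)/2$.
   Context: Graphs are finite, undirected and loopless; the order $|G|$ of a graph $G$ is its number of vertices. Let $k\ge1$. Two tuples $\bar u\in V(G)^k$ and $\bar v\in V(G')^k$ have the same isomorphism type, $[\bar u]=[\bar v]$, if for all $i,j$: $u_i=u_j$ iff $v_i=v_j$, and $u_i,u_j$ are adjacent in $G$ iff $v_i,v_j$ are adjacent in $G'$. For $w\in V(G)$ and $i\le k$, $\bar u^{i,w}$ denotes the result of substituting $w$ in place of $u_i$ in $\bar u$. The $k$-dimensional Weisfeiler-Lehman algorithm (in a relaxed version, where a set is used in the refinement step; the standard algorithm uses a multiset there) colors $k$-tuples of vertices as follows. Initial coloring: $W_G^{k,0}(\bar u)=[\bar u]$. Refinement step, $r\ge1$: $$W_G^{k,r}(\bar u)=\Bigl(W_G^{k,r-1}(\bar u),\ \bigl\{\bigl(W_G^{k,r-1}(\bar u^{1,w}),\ldots,W_G^{k,r-1}(\bar u^{k,w})\bigr): w\in V(G)\bigr\}\Bigr).$$ In the isomorphism testing mode, on input $G,G'$ (with disjoint vertex sets), let $\Pi^r$ be the partition of $V(G)^k\cup V(G')^k$ into classes of tuples with equal colors under $W_G^{k,r}$ and $W_{G'}^{k,r}$. The algorithm stops refinement as soon as $\Pi^r=\Pi^{r-1}$ and decides that $G\cong G'$ iff $$\{W_G^{k,r}(u,\ldots,u):u\in V(G)\}=\{W_{G'}^{k,r}(v,\ldots,v):v\in V(G')\}.$$ For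 graphs $G,G'$ of order $n$, the optimum dimension $\mathrm{WL}(G,G')$ is the smallest dimension $k$ for which the algorithm gives the right output on $G,G'$ in the isomorphism testing mode, and $\mathrm{WL}(n)=\max\{\mathrm{WL}(G,G') : G'\not\cong G,\ |G'|=|G|=n\}$.
   Formalization: Stated for n ≥ 3: for n ≤ 1 the maximum defining WL(n) is over an empty set, and for n = 2 the bound fails with the given definition, since the 1-dimensional algorithm cannot tell K_2 from its complement, so WL(2) = 2 > 3/2. -}

module Defs where

open import Level using (0ℓ)
open import Data.Bool using (Bool; false; T)
open import Data.Fin using (Fin)
open import Data.List using (List; map; allFin)
import Data.List.Relation.Binary.Subset.Setoid.Properties as Subsetₚ
open import Data.Nat using (ℕ; zero; suc; _≤_)
open import Data.Product using (Σ; ∃-syntax; _×_; _,_; proj₁; proj₂)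
open import Data.Product.Relation.Binary.Pointwise.NonDependent using (×-setoid)
open import Data.Sum using (_⊎_; [_,_]′)
open import Data.Vec using (Vec; lookup; replicate; tabulate; _[_]≔_)
import Data.Vec.Relation.Binary.Equality.Setoid as VecEq
open import Function using (_⇔_; _↔_; Inverse)
open import Function.Properties.Equivalence using (⇔-isEquivalence)
open import Relation.Binary using (Setoid; IsEquivalence; Rel)
open import Relation.Binary.Properties.Preorder using (InducedEquivalence)
open import Relation.Binary.PropositionalEquality using (_≡_)
open import Relation.Nullary using (¬_)

-- Vertices of a graph of order n are labelled by Fin n.
record Graph (n : ℕ) : Set where
  field
    adj      : Fin n → Fin n → Bool
    adj-sym  : ∀ u v → adj u v ≡ adj v u
    loopless : ∀ v → adj v v ≡ false

  Adjacent : Rel (Fin n) 0ℓ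
  Adjacent u v = T (adj u v)

open Graph public using (Adjacent)

record _≅_ {m n : ℕ} (G : Graph m) (G′ : Graph n) : Set where
  field
    bijection : Fin m ↔ Fin n
    preserves : ∀ u v → Adjacent G u v ⇔
      Adjacent G′ (Inverse.to bijection u) (Inverse.to bijection v)

Tuple : ℕ → ℕ → Set
Tuple n k = Vec (Fin n) k

GraphWithTuple : ℕ → Set
GraphWithTuple k = Σ ℕ λ n → Graph n × Tuple n k

SameIsoType : ∀ {k} → Rel (GraphWithTuple k) 0ℓ
SameIsoType (_ , G , u) (_ , G′ , v) = ∀ i j →
  ((lookup u i ≡ lookup u j) ⇔ (lookup v i ≡ lookup v j)) ×
  (Adjacent G (lookup u i) (lookup u j) ⇔ Adjacent G′ (lookup v i) (lookup v j))

-- An isomorphism type is given by a representative, compared with SameIsoType.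
isoTypeSetoid : ℕ → Setoid 0ℓ 0ℓ
isoTypeSetoid k = record
  { Carrier       = GraphWithTuple k
  ; _≈_           = SameIsoType
  ; isEquivalence = record
    { refl  = λ i j → E.refl , E.refl
    ; sym   = λ p i j → E.sym (proj₁ (p i j)) , E.sym (proj₂ (p i j))
    ; trans = λ p q i j → E.trans (proj₁ (p i j)) (proj₁ (q i j))
                        , E.trans (proj₂ (p i j)) (proj₂ (q i j))
    }
  }
  where module E = IsEquivalence (⇔-isEquivalence {ℓ = 0ℓ})

-- Finite sets are lists up to mutual inclusion: order and multiplicity of
-- elements are ignored.
finiteSetSetoid : Setoid 0ℓ 0ℓ → Setoid 0ℓ 0ℓ
finiteSetSetoid S = InducedEquivalence (Subsetₚ.⊆-preorder S)

-- The colours used in round r; the colour types do not depend on the graph, so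
-- colours of tuples from different graphs are comparable.
colourSetoid : (k r : ℕ) → Setoid 0ℓ 0ℓ
colourSetoid k zero    = isoTypeSetoid k
colourSetoid k (suc r) =
  ×-setoid (colourSetoid k r)
           (finiteSetSetoid (VecEq.≋-setoid (colourSetoid k r) k))

Colour : (k r : ℕ) → Set
Colour k r = Setoid.Carrier (colourSetoid k r)

SameColour : (k r : ℕ) → Rel (Colour k r) 0ℓ
SameColour k r = Setoid._≈_ (colourSetoid k r)

W : ∀ {n} (k r : ℕ) → Graph n → Tuple n k → Colour k r
W {n} k zero    G u = n , G , u
W {n} k (suc r) G u =
  W k r G u , map (λ w → tabulate λ i → W k r G (u [ i ]≔ w)) (allFin n)

module IsomorphismTest (k : ℕ) {m n : ℕ} (G : Graph m) (G′ : Graph n) where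

  -- The disjoint union of V(G)ᵏ and V(G′)ᵏ.
  Tuples : Set
  Tuples = Tuple m k ⊎ Tuple n k

  -- The partition Πʳ, as the relation of lying in the same class.
  Π : ℕ → Rel Tuples 0ℓ
  Π r s t = SameColour k r (colour s) (colour t)
    where
    colour : Tuples → Colour k r
    colour = [ W k r G , W k r G′ ]′

  Stable : ℕ → Set
  Stable r = ∃[ q ] r ≡ suc q × (∀ s t → Π r s t ⇔ Π q s t)

  StopsAfter : ℕ → Set
  StopsAfter r = Stable r × (∀ q → Stable q → r ≤ q)

  diagonalColours : ∀ {l} (r : ℕ) → Graph l → List (Colour k r)
  diagonalColours {l} r H = map (λ u → W k r H (replicate k u)) (allFin l)

  DecidesIsomorphicAfter : ℕ → Set
  DecidesIsomorphicAfter r =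
    Setoid._≈_ (finiteSetSetoid (colourSetoid k r))
      (diagonalColours r G) (diagonalColours r G′)

  RightOutput : Set
  RightOutput = ∃[ r ] StopsAfter r × (DecidesIsomorphicAfter r ⇔ G ≅ G′)

open IsomorphismTest public using (RightOutput)

IsLeast : (ℕ → Set) → ℕ → Set
IsLeast P m = P m × (∀ x → P x → m ≤ x)

IsGreatest : (ℕ → Set) → ℕ → Set
IsGreatest P m = P m × (∀ x → P x → x ≤ m)

-- IsOptimumDimension G G′ d says that WL(G, G′) = d.
IsOptimumDimension : ∀ {m n} → Graph m → Graph n → ℕ → Set
IsOptimumDimension G G′ = IsLeast (λ k → 1 ≤ k × RightOutput k G G′)

-- IsWL n d says that WL(n) = d.  For n ≤ 1 all graphs of order n are isomorphic,
-- so the maximum is over the empty set and there is no such d.  For n = 2 we have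
-- d = 2, because in dimension 1 all tuples have the same colour in every round.
IsWL : ℕ → ℕ → Set
IsWL n = IsGreatest (λ k →
  Σ (Graph n) λ G → Σ (Graph n) λ G′ → ¬ (G′ ≅ G) × IsOptimumDimension G G′ k)

{-# OPTIONS --safe #-}
module Submission where

-- Let k = ⌈n/2⌉.  If the stable k-dimensional colouring does not separate G from G′, then
-- Duplicator survives in the infinite game with k + 1 pebbles, and G ≅ G′ follows.
--
-- Call u, v outside a set X similar if they have the same neighbours in X.  Add to X a
-- vertex u ∉ X whenever u has a similar mate and some similar v, v′ ≠ u are told apart by
-- u: each such step increases the number of similarity classes outside X, so there are
-- always at least |X| + 1 of them, and the process stops with 2|X| + 1 ≤ n.  Pebble this
-- X; two pebbles remain.  The pairs (a, b) on which Duplicator can then answer match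
-- the twin classes of G with those of G′ and respect adjacency between them, so only the
-- sizes of matched classes can differ.  If a class of size s < k in one graph is matched
-- with a larger one, Spoiler wins by pebbling s + 1 vertices of the latter and
-- testing for twins with one more pebble.  As |G| = |G′|, differences in both
-- directions would give two disjoint classes of sizes ≥ k and ≥ k + 1 in one graph,
-- contradicting n ≤ 2k; with differences in one direction only, the twin classes of one
-- graph inject into those of the other.
--
-- That the maximum WL(n) exists is a finite search: graphs are enumerated by adjacency
-- matrices, and non-isomorphism is decided by the k-dimensional algorithm itself.

open import Defs
open import Data.Bool using (Bool; true; false; not; _∧_)
import Data.Bool as Bool
import Data.Bool.Properties as Bool
open import Data.Empty using (⊥-elim)
open import Data.Fin using (Fin; zero; suc; toℕ; splitAt; join; inject≤; fromℕ<)
import Data.Fin.Properties as Fin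
open import Data.List
  using (List; []; _∷_; _++_; length; map; filter; allFin; take; lookup; cartesianProductWith)
open import Data.List.Membership.Propositional using (_∈_; lose)
import Data.List.Membership.Propositional.Properties as ∈
open import Data.List.Properties
  using (length-++; length-take; filter-≐; length-map; length-tabulate)
open import Data.List.Relation.Binary.Subset.Propositional using (_⊆_)
import Data.List.Relation.Binary.Subset.DecSetoid as DecSubset
import Data.List.Relation.Binary.Subset.Propositional.Properties as ⊆
open import Data.List.Relation.Unary.All as All using (All; []; _∷_)
import Data.List.Relation.Unary.All.Properties as All
open import Data.List.Relation.Unary.AllPairs using ([]; _∷_)
open import Data.List.Relation.Unary.Any as Any using (Any; here; there; index)
import Data.List.Relation.Unary.Any.Properties as Any
open import Data.List.Relation.Unary.Unique.Propositional using (Unique)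
import Data.List.Relation.Unary.Unique.Propositional.Properties as Unique
open import Data.Nat using (ℕ; zero; suc; _+_; _*_; _≤_; _<_; z≤n; s≤s; s≤s⁻¹; ⌈_/2⌉; ⌊_/2⌋)
open import Data.Nat.Induction using (<-rec)
import Data.Nat.Properties as ℕ
open import Data.Product using (Σ; ∃; ∃₂; ∃-syntax; _×_; _,_; proj₁; proj₂; swap)
open import Data.Sum using (_⊎_; inj₁; inj₂; [_,_]′)
open import Data.Vec as Vec using (Vec; []; _∷_; _[_]≔_; replicate; tabulate)
import Data.Vec.Functional as F
import Data.Vec.Properties as Vec
import Data.Vec.Relation.Binary.Equality.Setoid as VecEq
import Data.Vec.Relation.Binary.Pointwise.Inductive as Pointwise
open import Function
  using (_⇔_; mk⇔; mk↔ₛ′; Equivalence; Inverse; Injection; _∘_; id; case_of_)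
open import Function.Construct.Symmetry using (⇔-sym)
open import Function.Definitions using (Injective)
open import Function.Properties.Inverse using (↔-trans; ↔⇒↣)
open import Level using (0ℓ)
open import Relation.Binary using (Setoid; DecSetoid; Rel; Decidable)
open import Relation.Binary.PropositionalEquality
  using (_≡_; _≢_; refl; sym; trans; cong; cong₂; subst)
open import Relation.Nullary using (¬_; Dec; yes; no; contradiction; ¬?; _×-dec_; _→-dec_)
open import Relation.Nullary.Decidable
  using (map′; decidable-stable; does; does-⇔; dec-true; dec-false)

open Graph
open Equivalence using (to; from)

-- Graphs and twin classes

module Separation {n : ℕ} (G : Graph n) where

  Outside : ∀ {m} → (Fin m → Fin n) → Fin n → Set
  Outside X v = ∀ i → X i ≢ v

  Similar : ∀ {m} → (Fin m → Fin n) → Fin n → Fin n → Set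
  Similar X u v = ∀ i → adj G (X i) u ≡ adj G (X i) v

  Mates : ∀ {m} → (Fin m → Fin n) → Fin n → Fin n → Set
  Mates X u v = Outside X u × Outside X v × Similar X u v

  -- `u′` keeps the class of `u` represented once `u` enters the base; `u ≢ v` and `u ≢ v′` keep
  -- both halves of the class of `v` outside it.
  Splits : ∀ {m} → (Fin m → Fin n) → (u u′ v v′ : Fin n) → Set
  Splits X u u′ v v′ =
    Mates X u u′ × Mates X v v′ × u ≢ u′ × u ≢ v × u ≢ v′ × adj G u v ≢ adj G u v′

  Unsplittable : ∀ {m} → (Fin m → Fin n) → Set
  Unsplittable X = ∀ u u′ v v′ → ¬ Splits X u u′ v v′

  outside? : ∀ {m} (X : Fin m → Fin n) v → Dec (Outside X v)
  outside? X v = Fin.all? λ i → ¬? (X i Fin.≟ v)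

  similar? : ∀ {m} (X : Fin m → Fin n) u v → Dec (Similar X u v)
  similar? X u v = Fin.all? λ i → adj G (X i) u Bool.≟ adj G (X i) v

  mates? : ∀ {m} (X : Fin m → Fin n) u v → Dec (Mates X u v)
  mates? X u v = outside? X u ×-dec outside? X v ×-dec similar? X u v

  splits? : ∀ {m} (X : Fin m → Fin n) u u′ v v′ → Dec (Splits X u u′ v v′)
  splits? X u u′ v v′ =
    mates? X u u′ ×-dec mates? X v v′ ×-dec ¬? (u Fin.≟ u′) ×-dec
    ¬? (u Fin.≟ v) ×-dec ¬? (u Fin.≟ v′) ×-dec ¬? (adj G u v Bool.≟ adj G u v′)

  -- The number of classes is bounded below by exhibiting representatives, so that no class has to
  -- be counted.
  record Separator (m : ℕ) : Set where
    field
      base         : Fin m → Fin n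
      reps         : Fin (suc m) → Fin n
      base-inj     : Injective _≡_ _≡_ base
      reps-outside : ∀ i → Outside base (reps i)
      reps-sep     : ∀ i j → Similar base (reps i) (reps j) → i ≡ j

    all-inj : Injective _≡_ _≡_ ([ base , reps ]′ ∘ splitAt m)
    all-inj {x} {y} eq =
      trans (sym (Fin.join-splitAt m (suc m) x))
        (trans (cong (join m (suc m)) (go (splitAt m x) (splitAt m y) eq))
          (Fin.join-splitAt m (suc m) y))
      where
      go : ∀ s t → [ base , reps ]′ s ≡ [ base , reps ]′ t → s ≡ t
      go (inj₁ i) (inj₁ j) p = cong inj₁ (base-inj p)
      go (inj₁ i) (inj₂ j) p = contradiction p (reps-outside j i)
      go (inj₂ i) (inj₁ j) p = contradiction (sym p) (reps-outside i j)
      go (inj₂ i) (inj₂ j) p =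
        cong inj₂ (reps-sep i j λ l → cong (adj G (base l)) p)

    size-bound : m + suc m ≤ n
    size-bound = Fin.injective⇒≤ all-inj

  -- Similarity over the enlarged base refines the old one, so the old representatives, replaced
  -- where necessary within their classes, stay apart; the class of `v` contributes `v′` in
  -- addition.
  grow : ∀ {m} (s : Separator m) → ∀ {u u′ v v′} →
         Splits (Separator.base s) u u′ v v′ → Separator (suc m)
  grow {m} s {u} {u′} {v} {v′}
       ((u-out , u′-out , u~u′) , (v-out , v′-out , v~v′) , u≢u′ , u≢v , u≢v′ , split) =
    record
    { base         = base₊
    ; reps         = reps₊
    ; base-inj     = base₊-inj
    ; reps-outside = reps₊-outside
    ; reps-sep     = reps₊-sep
    }
    where
    open Separator s
    base₊ : Fin (suc m) → Fin n
    base₊ = u F.∷ base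

    base₊-inj : Injective _≡_ _≡_ base₊
    base₊-inj {zero}  {zero}  eq = refl
    base₊-inj {zero}  {suc j} eq = contradiction (sym eq) (u-out j)
    base₊-inj {suc i} {zero}  eq = contradiction eq (u-out i)
    base₊-inj {suc i} {suc j} eq = cong suc (base-inj eq)

    outside₊ : ∀ {t} → u ≢ t → Outside base t → Outside base₊ t
    outside₊ u≢t out zero    = u≢t
    outside₊ u≢t out (suc i) = out i

    -- The class of v gets v as its representative, so that v′ can be added for the
    -- other half; u, which moves to the base, is replaced by its mate.
    replace : ∀ t → Outside base t → ∃[ t₊ ]
              Outside base₊ t₊ × Similar base t t₊ × (Similar base t v → t₊ ≡ v)
    replace t t-out with similar? base t v
    ... | yes t~v = v , outside₊ u≢v v-out , t~v , λ _ → refl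
    ... | no  t≁v with u Fin.≟ t
    ...   | yes refl = u′ , outside₊ u≢u′ u′-out , u~u′ , λ t~v → contradiction t~v t≁v
    ...   | no  u≢t  = t , outside₊ u≢t t-out , (λ _ → refl) , λ t~v → contradiction t~v t≁v

    new : ∀ i → ∃[ t₊ ] Outside base₊ t₊ × Similar base (reps i) t₊ ×
                        (Similar base (reps i) v → t₊ ≡ v)
    new i = replace (reps i) (reps-outside i)

    reps₊ : Fin (suc (suc m)) → Fin n
    reps₊ = v′ F.∷ λ i → proj₁ (new i)

    reps₊-outside : ∀ i → Outside base₊ (reps₊ i)
    reps₊-outside zero    = outside₊ u≢v′ v′-out
    reps₊-outside (suc i) = proj₁ (proj₂ (new i))

    -- A representative similar to `v′` over the new base stands for the old class of `v`, hence is
    -- `v` itself, which `u` tells apart from `v′`.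
    v′-new : ∀ i → ¬ Similar base₊ v′ (reps₊ (suc i))
    v′-new i sim = split (trans (cong (adj G u) (sym new≡v)) (sym (sim zero)))
      where
      new≡v = proj₂ (proj₂ (proj₂ (new i))) λ l →
        trans (proj₁ (proj₂ (proj₂ (new i))) l) (trans (sym (sim (suc l))) (sym (v~v′ l)))

    reps₊-sep : ∀ i j → Similar base₊ (reps₊ i) (reps₊ j) → i ≡ j
    reps₊-sep zero    zero    sim = refl
    reps₊-sep zero    (suc j) sim = contradiction sim (v′-new j)
    reps₊-sep (suc i) zero    sim = contradiction (sym ∘ sim) (v′-new i)
    reps₊-sep (suc i) (suc j) sim = cong suc (reps-sep i j λ l →
      trans (proj₁ (proj₂ (proj₂ (new i))) l)
        (trans (sim (suc l)) (sym (proj₁ (proj₂ (proj₂ (new j))) l))))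

  unsplittable-base : 1 ≤ n → ∃[ m ] m + suc m ≤ n × Σ (Fin m → Fin n) Unsplittable
  unsplittable-base (s≤s _) = search n trivial ℕ.≤-refl
    where
    trivial : Separator 0
    trivial = record
      { base         = λ ()
      -- Over the empty base all vertices are similar, so there is one class; `1 ≤ n` supplies its
      -- representative.
      ; reps         = λ _ → zero
      ; base-inj     = λ { {()} }
      ; reps-outside = λ _ ()
      ; reps-sep     = λ { zero zero _ → refl }
      }

    search : ∀ fuel {m} → Separator m → n ≤ m + fuel →
             ∃[ m ] m + suc m ≤ n × Σ (Fin m → Fin n) Unsplittable
    -- Out of fuel means `n ≤ m`, whereas the base and its representatives already occupy `2m + 1`
    -- vertices.
    search zero {m} s n≤ = contradiction
      (ℕ.≤-trans size-bound n≤) (ℕ.<⇒≱ (ℕ.+-monoʳ-< m ℕ.0<1+n))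
      where open Separator s
    search (suc fuel) {m} s n≤
      with Fin.any? (λ u → Fin.any? (λ u′ → Fin.any? (λ v → Fin.any? (λ v′ →
             splits? (Separator.base s) u u′ v v′))))
    ... | yes (_ , _ , _ , _ , sp) =
      search fuel (grow s sp) (subst (n ≤_) (ℕ.+-suc m fuel) n≤)
    ... | no ¬split = m , Separator.size-bound s , Separator.base s ,
      λ u u′ v v′ sp → ¬split (u , u′ , v , v′ , sp)

module Twins {n : ℕ} (G : Graph n) where

  -- Twins may be adjacent or not; in both cases exchanging `a` and `c` is an automorphism.
  Twin : Fin n → Fin n → Set
  Twin a c = ∀ w → w ≢ a → w ≢ c → adj G a w ≡ adj G c w

  twin-refl : ∀ {a} → Twin a a
  twin-refl w _ _ = refl

  twin-sym : ∀ {a c} → Twin a c → Twin c a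
  twin-sym t w w≢c w≢a = sym (t w w≢a w≢c)

  twin-trans : ∀ {a b c} → Twin a b → Twin b c → Twin a c
  twin-trans {a} {b} {c} ab bc w w≢a w≢c with w Fin.≟ b
  ... | no  w≢b = trans (ab w w≢a w≢b) (bc w w≢b w≢c)
  ... | yes refl with a Fin.≟ c
  ...   | yes refl = refl
  -- At `w = b` neither hypothesis speaks about `w`. The pair `a`, `c` mediates: `bc` at `a`
  -- compares it with the pair `a`, `b`, and `ab` at `c` with the pair `b`, `c`.
  ...   | no  a≢c  =
    trans (adj-sym G a w) (trans (bc a (w≢a ∘ sym) a≢c)
      (trans (adj-sym G c a) (trans (ab c (a≢c ∘ sym) (w≢c ∘ sym)) (adj-sym G w c))))

  twin? : ∀ a c → Dec (Twin a c)
  twin? a c = Fin.all? λ w →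
    ¬? (w Fin.≟ a) →-dec (¬? (w Fin.≟ c) →-dec (adj G a w Bool.≟ adj G c w))

  -- Exchange `a` for `c`, then `e` for `f`. The first exchange is blocked if `e = c`; all four
  -- vertices then lie in one class, and `a` is exchanged for `f` directly unless `f = a`, where
  -- symmetry suffices.
  twins-adj : ∀ {a c e f} → Twin a c → Twin e f → a ≢ e → c ≢ f →
              adj G a e ≡ adj G c f
  twins-adj {a} {c} {e} {f} ac ef a≢e c≢f with e Fin.≟ c
  ... | no e≢c = trans (ac e (a≢e ∘ sym) e≢c)
    (trans (adj-sym G c e) (trans (ef c (e≢c ∘ sym) c≢f) (adj-sym G f c)))
  ... | yes refl with f Fin.≟ a
  ...   | yes refl = adj-sym G f e
  ...   | no  f≢a  = trans (twin-trans ac ef e (a≢e ∘ sym) c≢f) (adj-sym G f e)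

  twins : Fin n → List (Fin n)
  twins a = filter (twin? a) (allFin n)

  ∈-twins⁺ : ∀ {a c} → Twin a c → c ∈ twins a
  ∈-twins⁺ t = ∈.∈-filter⁺ (twin? _) (∈.∈-allFin _) t

  ∈-twins⁻ : ∀ {a c} → c ∈ twins a → Twin a c
  ∈-twins⁻ {a} c∈ = proj₂ (∈.∈-filter⁻ (twin? a) {xs = allFin n} c∈)

  twins-unique : ∀ a → Unique (twins a)
  twins-unique a = Unique.filter⁺ (twin? a) (Unique.allFin⁺ n)

  twins-cong : ∀ {a c} → Twin a c → twins a ≡ twins c
  twins-cong {a} {c} t = filter-≐ (twin? a) (twin? c)
    (twin-trans (twin-sym t) , twin-trans t) (allFin n)

  class-size : Fin n → ℕ
  class-size a = length (twins a)

-- Repetition-free lists, and isomorphisms from injections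

module _ {A : Set} where

  -- The twin lists of two twins are only propositionally equal, so indices into them have different
  -- types and are compared through `toℕ`.
  lookup-cong : ∀ {xs ys : List A} {i j} → xs ≡ ys → toℕ i ≡ toℕ j → lookup xs i ≡ lookup ys j
  lookup-cong {xs} refl eq = cong (lookup xs) (Fin.toℕ-injective eq)

  lookup-injective : ∀ {xs ys : List A} → Unique xs → xs ≡ ys → ∀ i j →
                     lookup xs i ≡ lookup ys j → toℕ i ≡ toℕ j
  lookup-injective (x∉ ∷ u) refl zero    zero    eq = refl
  lookup-injective (x∉ ∷ u) refl zero    (suc j) eq =
    contradiction eq (All.lookup x∉ (∈.∈-lookup j))
  lookup-injective (x∉ ∷ u) refl (suc i) zero    eq =
    contradiction (sym eq) (All.lookup x∉ (∈.∈-lookup i))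
  lookup-injective (x∉ ∷ u) refl (suc i) (suc j) eq = cong suc (lookup-injective u refl i j eq)

  unique-⊆⇒length≤ : ∀ {xs ys : List A} → Unique xs → xs ⊆ ys → length xs ≤ length ys
  unique-⊆⇒length≤ {xs} {ys} u xs⊆ys = Fin.injective⇒≤ position-inj
    where
    position : Fin (length xs) → Fin (length ys)
    position i = index (xs⊆ys (∈.∈-lookup i))

    position-inj : Injective _≡_ _≡_ position
    position-inj {i} {j} eq = Fin.toℕ-injective (lookup-injective u refl i j
      (trans (Any.lookup-index (xs⊆ys (∈.∈-lookup i)))
        (trans (cong (lookup ys) eq) (sym (Any.lookup-index (xs⊆ys (∈.∈-lookup j)))))))

unique-map : ∀ {A B C : Set} {f : A → B} {g : A → C} (xs : List A) →
             (∀ {x y} → x ∈ xs → y ∈ xs → f x ≡ f y → g x ≡ g y) →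
             Unique (map g xs) → Unique (map f xs)
unique-map []       _   _        = []
unique-map (x ∷ xs) inj (x∉ ∷ u) =
  All.map⁺ (All.tabulate λ y∈ fx≡fy →
    All.lookup (All.map⁻ x∉) y∈ (inj (here refl) (there y∈) fx≡fy))
  ∷ unique-map xs (λ x∈ y∈ → inj (there x∈) (there y∈)) u

Fin-injective⇒surjective : ∀ {n} {f : Fin n → Fin n} → Injective _≡_ _≡_ f →
                           ∀ y → ∃[ x ] f x ≡ y
Fin-injective⇒surjective {f = f} inj y =
  decidable-stable (Fin.any? λ x → f x Fin.≟ y) λ missed →
    -- Prepending the missed `y` would extend `f` to an injection of `n + 1` elements into `n`.
    Fin.<⇒notInjective {f = y F.∷ f} ℕ.≤-refl
      λ { {zero}  {zero}  eq → refl
        ; {zero}  {suc j} eq → contradiction (j , sym eq) missed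
        ; {suc i} {zero}  eq → contradiction (i , eq) missed
        ; {suc i} {suc j} eq → cong suc (inj eq)
        }

≅-sym : ∀ {m n} {G : Graph m} {G′ : Graph n} → G ≅ G′ → G′ ≅ G
≅-sym {G = G} {G′} iso = record
  { bijection = mk↔ₛ′ β.from β.to β.strictlyInverseʳ β.strictlyInverseˡ
  ; preserves = λ u v → mk⇔
      (λ e → from (preserves (β.from u) (β.from v))
        (adjust (sym (β.strictlyInverseˡ u)) (sym (β.strictlyInverseˡ v)) e))
      (λ e → adjust (β.strictlyInverseˡ u) (β.strictlyInverseˡ v)
        (to (preserves (β.from u) (β.from v)) e))
  }
  where
  open _≅_ iso
  module β = Inverse bijection
  adjust : ∀ {u u′ v v′} → u ≡ u′ → v ≡ v′ → Adjacent G′ u v → Adjacent G′ u′ v′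
  adjust refl refl e = e

injection⇒≅ : ∀ {n} {G G′ : Graph n} (f : Fin n → Fin n) → Injective _≡_ _≡_ f →
              (∀ a c → a ≢ c → adj G a c ≡ adj G′ (f a) (f c)) → G ≅ G′
injection⇒≅ {G = G} {G′} f inj pres = record
  { bijection = mk↔ₛ′ f (proj₁ ∘ onto) (proj₂ ∘ onto) (λ x → inj (proj₂ (onto (f x))))
  ; preserves = λ u v → mk⇔ (subst Bool.T (pres′ u v)) (subst Bool.T (sym (pres′ u v)))
  }
  where
  onto = Fin-injective⇒surjective inj
  pres′ : ∀ a c → adj G a c ≡ adj G′ (f a) (f c)
  pres′ a c with a Fin.≟ c
  ... | yes refl = trans (loopless G a) (sym (loopless G′ (f a)))
  ... | no  a≢c  = pres a c a≢c

open Separation using (Mates; Unsplittable; unsplittable-base)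
open Twins

-- The pebble game

-- Duplicator's winning positions in the pebble game with k + 1 pebbles: a further pair
-- is placed only while length p ≤ k, and weaken picks pebbles up.
record Game {m n : ℕ} (G : Graph m) (G′ : Graph n) (k : ℕ) : Set₁ where
  field
    Survives : List (Fin m × Fin n) → Set
    start    : Survives []
    local    : ∀ {p a b c d} → Survives p → (a , b) ∈ p → (c , d) ∈ p →
               (a ≡ c ⇔ b ≡ d) × adj G a c ≡ adj G′ b d
    weaken   : ∀ {p q} → q ⊆ p → Survives p → Survives q
    forth    : ∀ {p} → Survives p → length p ≤ k → ∀ a → ∃[ b ] Survives ((a , b) ∷ p)
    back     : ∀ {p} → Survives p → length p ≤ k → ∀ b → ∃[ a ] Survives ((a , b) ∷ p)

-- What two free pebbles reveal: one stands on `a`, the other compares it with `c`. `Matched` is a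
-- relation, so the answer `d` may depend on the pair `(a , b)`.
record Matching {m n : ℕ} (G : Graph m) (G′ : Graph n) : Set₁ where
  field
    Matched  : Fin m → Fin n → Set
    partner  : ∀ a → ∃[ b ] Matched a b
    partner′ : ∀ b → ∃[ a ] Matched a b
    forth    : ∀ {a b} → Matched a b → ∀ c → ∃[ d ]
               Matched c d × (a ≡ c ⇔ b ≡ d) × adj G a c ≡ adj G′ b d
    back     : ∀ {a b} → Matched a b → ∀ d → ∃[ c ]
               Matched c d × (a ≡ c ⇔ b ≡ d) × adj G a c ≡ adj G′ b d

  RespectsTwins : Set
  RespectsTwins = ∀ {a b c d} → Matched a b → Matched c d → Twin G a c ⇔ Twin G′ b d

  Collapses : Set
  Collapses = ∀ {a b c} → Matched a b → Matched c b → Twin G a c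

matching-flip : ∀ {m n} {G : Graph m} {G′ : Graph n} → Matching G G′ → Matching G′ G
matching-flip M = record
  { Matched  = λ b a → Matched a b
  ; partner  = partner′
  ; partner′ = partner
  ; forth    = λ e d → let c , e′ , eqs , adjs = back e d in c , e′ , ⇔-sym eqs , sym adjs
  ; back     = λ e c → let d , e′ , eqs , adjs = forth e c in d , e′ , ⇔-sym eqs , sym adjs
  }
  where open Matching M

module _ {m n : ℕ} {G : Graph m} {G′ : Graph n} where

  open Matching

  -- Pull `w` back twice, against `(a , b)` and against `(c , d)`. The two preimages share the image
  -- `w`, so they are twins, and `twins-adj` compares their adjacencies to `a` and `c`.
  twins-preserved : (M : Matching G G′) → Collapses M → ∀ {a b c d} →
                    Matched M a b → Matched M c d → Twin G a c → Twin G′ b d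
  twins-preserved M collapse ab cd a~c w w≢b w≢d
    with e  , ew  , a≡e⇔b≡w  , ae≡bw  ← back M ab w
       | e′ , e′w , c≡e′⇔d≡w , ce′≡dw ← back M cd w =
    trans (sym ae≡bw)
      (trans (twins-adj G a~c (collapse ew e′w) (w≢b ∘ sym ∘ to a≡e⇔b≡w) (w≢d ∘ sym ∘ to c≡e′⇔d≡w))
        ce′≡dw)

-- Collapse in `G′` follows from collapse in `G`: preservation applied to `a` as its own twin makes
-- any two matches of `a` twins. The converse direction is then preservation for the flipped
-- matching.
collapses⇒respects : ∀ {m n} {G : Graph m} {G′ : Graph n} (M : Matching G G′) →
                     Matching.Collapses M → Matching.RespectsTwins M
collapses⇒respects {G = G} M collapse ab cd = mk⇔ (twins-preserved M collapse ab cd)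
  (twins-preserved (matching-flip M)
    (λ ab ad → twins-preserved M collapse ab ad (twin-refl G)) ab cd)

module Classwise {n : ℕ} {G G′ : Graph n}
  (M : Matching G G′) (respects : Matching.RespectsTwins M) where

  open Matching M

  β : Fin n → Fin n
  β a = proj₁ (partner a)

  rank : ∀ a → Fin (class-size G a)
  rank a = index (∈-twins⁺ G (twin-refl G {a}))

  -- Each `a` goes to the member of the class of `β a` whose position there is the rank of `a` in
  -- its own class. Both orders being `n`, injectivity is enough.
  fitting⇒≅ : (∀ a → class-size G a ≤ class-size G′ (β a)) → G ≅ G′
  fitting⇒≅ fits = injection⇒≅ f f-inj f-adj
    where
    f : Fin n → Fin n
    f a = lookup (twins G′ (β a)) (inject≤ (rank a) (fits a))

    β~f : ∀ a → Twin G′ (β a) (f a)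
    β~f a = ∈-twins⁻ G′ (∈.∈-lookup {xs = twins G′ (β a)} (inject≤ (rank a) (fits a)))

    f-inj : Injective _≡_ _≡_ f
    f-inj {a} {c} eq =
      trans (Any.lookup-index (∈-twins⁺ G (twin-refl G {a})))
        (trans (lookup-cong {i = rank a} {rank c} (twins-cong G a~c) ranks≡)
          (sym (Any.lookup-index (∈-twins⁺ G (twin-refl G {c})))))
      where
      βa~βc : Twin G′ (β a) (β c)
      βa~βc = twin-trans G′ (subst (Twin G′ (β a)) eq (β~f a)) (twin-sym G′ (β~f c))
      a~c = from (respects (proj₂ (partner a)) (proj₂ (partner c))) βa~βc
      ranks≡ : toℕ (rank a) ≡ toℕ (rank c)
      ranks≡ = trans (sym (Fin.toℕ-inject≤ (rank a) (fits a)))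
        (trans (lookup-injective (twins-unique G′ (β a)) (twins-cong G′ βa~βc) _ _ eq)
          (Fin.toℕ-inject≤ (rank c) (fits c)))

    f-adj : ∀ a c → a ≢ c → adj G a c ≡ adj G′ (f a) (f c)
    -- The answer `d` to `c` may differ from both `β c` and `f c`, but it is a twin of each.
    f-adj a c a≢c with d , cd , a≡c⇔βa≡d , ac≡βad ← forth (proj₂ (partner a)) c =
      trans ac≡βad (twins-adj G′ (β~f a) (twin-trans G′ d~βc (β~f c))
        (a≢c ∘ from a≡c⇔βa≡d) (a≢c ∘ f-inj))
      where
      d~βc : Twin G′ d (β c)
      d~βc = to (respects cd (proj₂ (partner c))) (twin-refl G)

game-flip : ∀ {m n k} {G : Graph m} {G′ : Graph n} → Game G G′ k → Game G′ G k
game-flip {k = k} game = record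
  { Survives = λ p → Survives (map swap p)
  ; start    = start
  ; local    = λ s x y → let eqs , adjs = local s (∈.∈-map⁺ swap x) (∈.∈-map⁺ swap y) in
                 ⇔-sym eqs , sym adjs
  ; weaken   = λ q⊆p → weaken (⊆.map⁺ swap q⊆p)
  ; forth    = λ {p} s l → back s (subst (_≤ k) (sym (length-map swap p)) l)
  ; back     = λ {p} s l → forth s (subst (_≤ k) (sym (length-map swap p)) l)
  }
  where open Game game

-- Spoiler's strategies

module Pebbling {m n k : ℕ} {G : Graph m} {G′ : Graph n} (game : Game G G′ k) where

  open Game game

  drop-second : ∀ {x y : Fin m × Fin n} {p} → x ∷ p ⊆ x ∷ y ∷ p
  drop-second (here eq)  = here eq
  drop-second (there x∈) = there (there x∈)

  record Pebbled {l} (X : Fin l → Fin m) : Set where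
    field
      position : List (Fin m × Fin n)
      size     : length position ≡ l
      survives : Survives position
      image    : ∀ i → ∃[ b ] (X i , b) ∈ position

  pebble : ∀ l (X : Fin l → Fin m) → l ≤ k → Pebbled X
  pebble zero    X l≤k = record { position = [] ; size = refl ; survives = start ; image = λ () }
  pebble (suc l) X l<k
    with p ← pebble l (X ∘ suc) (ℕ.<⇒≤ l<k)
    with b , s ← forth (Pebbled.survives p)
                       (subst (_≤ k) (sym (Pebbled.size p)) (ℕ.<⇒≤ l<k)) (X zero) = record
    { position = (X zero , b) ∷ Pebbled.position p
    ; size     = cong suc (Pebbled.size p)
    ; survives = s
    ; image    = λ { zero    → b , here refl
                   ; (suc i) → let b , b∈ = Pebbled.image p i in b , there b∈ }
    }

  module _ {l} {X : Fin l → Fin m} (P : Pebbled X) (l<k : l < k) where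

    open Pebbled P

    matching : Matching G G′
    matching = record
      { Matched  = λ a b → Survives ((a , b) ∷ position)
      ; partner  = forth survives size≤k
      ; partner′ = back survives size≤k
      -- Now `l + 2` pebbles are down, which `l < k` permits. After the comparison the one on
      -- `(a , b)` is picked up, so that `(c , d)` alone stands beside the base.
      ; forth    = λ s c → let d , s′ = forth s size<k c in
          d , weaken drop-second s′ , local s′ (there (here refl)) (here refl)
      ; back     = λ s d → let c , s′ = back s size<k d in
          c , weaken drop-second s′ , local s′ (there (here refl)) (here refl)
      }
      where
      size<k : suc (length position) ≤ k
      size<k = subst (_< k) (sym size) l<k
      size≤k : length position ≤ k
      size≤k = ℕ.<⇒≤ size<k

    open Matching matching hiding (forth; back)

    -- The pebble on `X i` is present in both positions: if it stands on `a`, its image is `b`, and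
    -- then `X i` is `c` too.
    same-image⇒outside : ∀ {a b c} → Matched a b → Matched c b → a ≢ c →
                         Separation.Outside G X a
    same-image⇒outside ab cb a≢c i Xi≡a = a≢c (trans (sym Xi≡a) (from c-eq (to a-eq Xi≡a)))
      where
      a-eq = proj₁ (local ab (there (proj₂ (image i))) (here refl))
      c-eq = proj₁ (local cb (there (proj₂ (image i))) (here refl))

    same-image⇒mates : ∀ {a b c} → Matched a b → Matched c b → a ≢ c → Mates G X a c
    same-image⇒mates ab cb a≢c =
      same-image⇒outside ab cb a≢c , same-image⇒outside cb ab (a≢c ∘ sym) , λ i →
      trans (proj₂ (local ab (there (proj₂ (image i))) (here refl)))
        (sym (proj₂ (local cb (there (proj₂ (image i))) (here refl))))

    -- Answer `w` by `d` against `(a , b)`, then `d` by `w′` against `(c , b)`; thus `w` relates to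
    -- `a` as `w′` does to `c`. If `w ≢ w′`, the two are mates with common image `d`, so a
    -- disagreement of `a` and `c` at `w` would be a split.
    unsplittable⇒collapses : Unsplittable G X → Collapses
    unsplittable⇒collapses unsplit {a} {b} {c} ab cb w w≢a w≢c with a Fin.≟ c
    ... | yes refl = refl
    ... | no  a≢c
      with d  , wd  , _ , aw≡bd  ← Matching.forth matching ab w
      with w′ , w′d , _ , cw′≡bd ← Matching.back matching cb d
      with w Fin.≟ w′
    ... | yes refl = trans aw≡bd (sym cw′≡bd)
    ... | no  w≢w′ = decidable-stable (adj G a w Bool.≟ adj G c w) λ aw≢cw →
      unsplit w w′ a c (same-image⇒mates wd w′d w≢w′ , same-image⇒mates ab cb a≢c
        , w≢w′ , w≢a , w≢c
        , λ wa≡wc → aw≢cw (trans (adj-sym G a w) (trans wa≡wc (adj-sym G w c))))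

  module _ {a : Fin m} {b : Fin n} (ab : Survives ((a , b) ∷ [])) where

    record Copy (ds : List (Fin n)) : Set where
      field
        pairs    : List (Fin m × Fin n)
        images   : map proj₂ pairs ≡ ds
        survives : Survives (pairs ++ (a , b) ∷ [])

      size : length (pairs ++ (a , b) ∷ []) ≡ suc (length ds)
      size = trans (length-++ pairs) (trans (ℕ.+-comm (length pairs) 1)
        (cong suc (trans (sym (length-map proj₂ pairs)) (cong length images))))

    copy : ∀ ds → length ds ≤ k → Copy ds
    copy []       l≤k = record { pairs = [] ; images = refl ; survives = ab }
    copy (d ∷ ds) l<k
      with p ← copy ds (ℕ.<⇒≤ l<k)
      with c , s ← back (Copy.survives p) (subst (_≤ k) (sym (Copy.size p)) l<k) d = record
      { pairs    = (c , d) ∷ Copy.pairs p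
      ; images   = cong (d ∷_) (Copy.images p)
      ; survives = s
      }

    -- With `(a , b)` and all of `ds` pebbled, the strict bound leaves one pebble, which tests the
    -- copies for twinship with `a` at an arbitrary `w`.
    copy-twins : ∀ ds → length ds < k → Unique ds → All (λ d → b ≢ d × Twin G′ b d) ds →
                 ∃[ cs ] length cs ≡ length ds × Unique cs × All (λ c → a ≢ c × Twin G a c) cs
    copy-twins ds l<k unique twin-ds = map proj₁ pairs
      , trans (length-map proj₁ pairs) (trans (sym (length-map proj₂ pairs)) (cong length images))
      , unique-map pairs (λ x∈ y∈ → to (proj₁ (local survives (∈.∈-++⁺ˡ x∈) (∈.∈-++⁺ˡ y∈))))
          (subst Unique (sym images) unique)
      , All.map⁺ (All.tabulate λ {x} x∈ → twin x∈
          (All.lookup twin-ds (subst (proj₂ x ∈_) images (∈.∈-map⁺ proj₂ x∈))))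
      where
      open Copy (copy ds (ℕ.<⇒≤ l<k))

      twin : ∀ {c d} → (c , d) ∈ pairs → b ≢ d × Twin G′ b d → a ≢ c × Twin G a c
      twin {c} {d} cd∈ (b≢d , b~d) = b≢d ∘ to (proj₁ (local survives ab∈ (∈.∈-++⁺ˡ cd∈))) , a~c
        where
        ab∈ : (a , b) ∈ pairs ++ (a , b) ∷ []
        ab∈ = ∈.∈-++⁺ʳ pairs (here refl)

        a~c : Twin G a c
        a~c w w≢a w≢c with w′ , s ← forth survives (subst (_≤ k) (sym size) l<k) w =
          trans (proj₂ aw) (trans (b~d w′ (w≢a ∘ sym ∘ from (proj₁ aw) ∘ sym)
            (w≢c ∘ sym ∘ from (proj₁ cw) ∘ sym)) (sym (proj₂ cw)))
          where
          aw = local s (there ab∈) (here refl)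
          cw = local s (there (∈.∈-++⁺ˡ cd∈)) (here refl)

    smaller-class⇒large : class-size G a < class-size G′ b → k ≤ class-size G a
    smaller-class⇒large a<b with k ℕ.≤? class-size G a
    ... | yes k≤ = k≤
    ... | no  k≰ = contradiction a∷cs-fits (ℕ.<⇒≱ (ℕ.≤-reflexive (cong suc (sym cs-length))))
      where
      distinct? = λ d → ¬? (b Fin.≟ d)
      others = filter distinct? (twins G′ b)
      -- Together with `b`, whose partner is `a`, this is one vertex more than the class of `a` can
      -- hold.
      ds = take (class-size G a) others

      b-class : twins G′ b ⊆ b ∷ others
      b-class {d} d∈ with b Fin.≟ d
      ... | yes refl = here refl
      ... | no  b≢d  = there (∈.∈-filter⁺ distinct? d∈ b≢d)

      ds-length : length ds ≡ class-size G a
      ds-length = trans (length-take (class-size G a) others) (ℕ.m≤n⇒m⊓n≡m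
        (s≤s⁻¹ (ℕ.≤-trans a<b (unique-⊆⇒length≤ (twins-unique G′ b) b-class))))

      copied = copy-twins ds (subst (_< k) (sym ds-length) (ℕ.≰⇒> k≰))
        (Unique.take⁺ (class-size G a) (Unique.filter⁺ distinct? (twins-unique G′ b)))
        (All.take⁺ (class-size G a) (All.tabulate λ d∈ →
          let d∈twins , b≢d = ∈.∈-filter⁻ distinct? {xs = twins G′ b} d∈ in
          b≢d , ∈-twins⁻ G′ d∈twins))

      cs = proj₁ copied
      cs-twins = proj₂ (proj₂ (proj₂ copied))

      cs-length : length cs ≡ class-size G a
      cs-length = trans (proj₁ (proj₂ copied)) ds-length

      a∷cs-fits : suc (length cs) ≤ class-size G a
      a∷cs-fits = unique-⊆⇒length≤
        (All.map proj₁ cs-twins ∷ proj₁ (proj₂ (proj₂ copied)))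
        λ { (here refl) → ∈-twins⁺ G (twin-refl G)
          ; (there c∈)  → ∈-twins⁺ G (proj₂ (All.lookup cs-twins c∈)) }

disjoint-classes : ∀ {n} (G : Graph n) {a c} → ¬ Twin G a c →
                   class-size G a + class-size G c ≤ n
disjoint-classes {n} G {a} {c} a≁c = begin
  class-size G a + class-size G c     ≡⟨ length-++ (twins G a) ⟨
  length (twins G a ++ twins G c)     ≤⟨ unique-⊆⇒length≤ classes-unique (λ _ → ∈.∈-allFin _) ⟩
  length (allFin n)                   ≡⟨ length-tabulate id ⟩
  n                                   ∎
  where
  open ℕ.≤-Reasoning
  classes-unique : Unique (twins G a ++ twins G c)
  classes-unique = Unique.++⁺ (twins-unique G a) (twins-unique G c) λ (x∈a , x∈c) →
    a≁c (twin-trans G (∈-twins⁻ G x∈a) (twin-sym G (∈-twins⁻ G x∈c)))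

game⇒≅ : ∀ {n k} {G G′ : Graph n} → 1 ≤ n → n ≤ k + k → Game G G′ k → G ≅ G′
game⇒≅ {n} {k} {G} {G′} 1≤n n≤2k game
  with m , m+sm≤n , X , unsplit ← unsplittable-base G 1≤n = decide
  where
  m<k : m < k
  m<k = ℕ.≰⇒> λ k≤m → ℕ.<⇒≱
    (ℕ.<-≤-trans (ℕ.+-monoʳ-< m (ℕ.n<1+n m)) m+sm≤n) (ℕ.≤-trans n≤2k (ℕ.+-mono-≤ k≤m k≤m))

  open Pebbling game
  base : Pebbled X
  base = pebble m X (ℕ.<⇒≤ m<k)

  M : Matching G G′
  M = matching base m<k
  open Matching M using (Matched; partner; partner′)

  M-respects : Matching.RespectsTwins M
  M-respects = collapses⇒respects M (unsplittable⇒collapses base m<k unsplit)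

  single : ∀ {a b} → Matched a b → Game.Survives game ((a , b) ∷ [])
  single = Game.weaken game λ { (here eq) → here eq }

  same-size : ∀ {a c} (H : Graph n) → Twin H a c → class-size H a ≡ class-size H c
  same-size H t = cong length (twins-cong H t)

  decide : G ≅ G′
  decide with Fin.any? (λ a → class-size G a ℕ.<? class-size G′ (proj₁ (partner a)))
            | Fin.any? (λ b → class-size G′ b ℕ.<? class-size G (proj₁ (partner′ b)))
  -- `partner′ b` need not be `a`, but both are matched with `b`, so they are twins and have equal
  -- class sizes.
  ... | _ | no none = Classwise.fitting⇒≅ M M-respects λ a →
    let b , ab = partner a ; c , cb = partner′ b in
    subst (_≤ class-size G′ b)
      (same-size G (from (M-respects cb ab) (twin-refl G′)))
      (ℕ.≮⇒≥ λ lt → none (b , lt))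
  ... | no none | _ = ≅-sym (Classwise.fitting⇒≅ (matching-flip M)
    (λ ba dc → ⇔-sym (M-respects ba dc)) λ b →
    let a , ab = partner′ b ; d , ad = partner a in
    subst (_≤ class-size G a)
      (same-size G′ (to (M-respects ad ab) (twin-refl G)))
      (ℕ.≮⇒≥ λ lt → none (a , lt)))
  ... | yes (a , a<b) | yes (d , d<c) = contradiction n≤2k (ℕ.<⇒≱ (begin-strict
    k + k                            <⟨ ℕ.+-mono-≤-< k≤a (ℕ.≤-<-trans k≤d d<c) ⟩
    class-size G a + class-size G c  ≤⟨ disjoint-classes G a≁c ⟩
    n                                ∎))
    where
    open ℕ.≤-Reasoning
    b = proj₁ (partner a)
    c = proj₁ (partner′ d)
    ab = proj₂ (partner a)
    cd = proj₂ (partner′ d)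
    k≤a = smaller-class⇒large (single ab) a<b
    k≤d = Pebbling.smaller-class⇒large (game-flip game) (single cd) d<c
    a≁c : ¬ Twin G a c
    -- If `a` and `c` were twins, so would be `b` and `d`, and the two strict inequalities would
    -- oppose each other.
    a≁c a~c = ℕ.<-asym a<b (begin-strict
      class-size G′ b  ≡⟨ same-size G′ (to (M-respects ab cd) a~c) ⟩
      class-size G′ d  <⟨ d<c ⟩
      class-size G c   ≡⟨ same-size G a~c ⟨
      class-size G a   ∎)

-- Colour refinement and the game

SameSet : (S : Setoid 0ℓ 0ℓ) → Rel (List (Setoid.Carrier S)) 0ℓ
SameSet S = Setoid._≈_ (finiteSetSetoid S)

module _ (S : Setoid 0ℓ 0ℓ) where

  open Setoid S renaming (Carrier to A; refl to ≈-refl; sym to ≈-sym)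

  module _ {m n : ℕ} {f : Fin m → A} {g : Fin n → A} where

    private
      ∈-image : ∀ {l} (h : Fin l → A) {x} i → x ≈ h i → Any (x ≈_) (map h (allFin l))
      ∈-image h i eq = Any.map⁺ (lose (∈.∈-allFin i) eq)

    sameSet⁻ : SameSet S (map f (allFin m)) (map g (allFin n)) →
               (∀ a → ∃[ b ] f a ≈ g b) × (∀ b → ∃[ a ] f a ≈ g b)
    sameSet⁻ (f⊆g , g⊆f) =
      (λ a → Any.satisfied (Any.map⁻ (f⊆g (∈-image f a ≈-refl)))) ,
      (λ b → let a , eq = Any.satisfied (Any.map⁻ (g⊆f (∈-image g b ≈-refl))) in a , ≈-sym eq)

    sameSet⁺ : (∀ a → ∃[ b ] f a ≈ g b) → (∀ b → ∃[ a ] f a ≈ g b) →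
               SameSet S (map f (allFin m)) (map g (allFin n))
    sameSet⁺ to-g to-f =
      (λ x∈ → let a , x≈fa = Any.satisfied (Any.map⁻ x∈) ; b , fa≈gb = to-g a in
        ∈-image g b (Setoid.trans S x≈fa fa≈gb)) ,
      (λ x∈ → let b , x≈gb = Any.satisfied (Any.map⁻ x∈) ; a , fa≈gb = to-f b in
        ∈-image f a (Setoid.trans S x≈gb (≈-sym fa≈gb)))

  sameSet? : Decidable _≈_ → Decidable (SameSet S)
  sameSet? _≟_ xs ys = (xs ⊆? ys) ×-dec (ys ⊆? xs)
    where
    decSetoid : DecSetoid 0ℓ 0ℓ
    decSetoid = record { isDecEquivalence = record { isEquivalence = isEquivalence ; _≟_ = _≟_ } }
    _⊆?_ = DecSubset._⊆?_ decSetoid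

_⇔?_ : ∀ {A B : Set} → Dec A → Dec B → Dec (A ⇔ B)
a? ⇔? b? = map′ (λ (f , g) → mk⇔ f g) (λ e → to e , from e) ((a? →-dec b?) ×-dec (b? →-dec a?))

sameColour? : ∀ k r → Decidable (SameColour k r)
sameColour? k zero (_ , G , u) (_ , G′ , v) = Fin.all? λ i → Fin.all? λ j →
  ((Vec.lookup u i Fin.≟ Vec.lookup u j) ⇔? (Vec.lookup v i Fin.≟ Vec.lookup v j)) ×-dec
  (Bool.T? (adj G (Vec.lookup u i) (Vec.lookup u j)) ⇔?
   Bool.T? (adj G′ (Vec.lookup v i) (Vec.lookup v j)))
sameColour? k (suc r) (c , cs) (d , ds) =
  sameColour? k r c d ×-dec
  sameSet? (VecEq.≋-setoid (colourSetoid k r) k) (Pointwise.decidable (sameColour? k r)) cs ds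

T-⇔⇒≡ : ∀ {x y} → Bool.T x ⇔ Bool.T y → x ≡ y
T-⇔⇒≡ {false} {false} e = refl
T-⇔⇒≡ {false} {true}  e = ⊥-elim (from e _)
T-⇔⇒≡ {true}  {false} e = ⊥-elim (to e _)
T-⇔⇒≡ {true}  {true}  e = refl

-- If every `y` were hit, choosing preimages would inject `Fin n` into `Fin m`. This finds the idle
-- pebble.
missed : ∀ {m n} → m < n → (f : Fin m → Fin n) → ∃[ y ] ∀ x → f x ≢ y
missed m<n f =
  decidable-stable (Fin.any? λ y → Fin.all? λ x → ¬? (f x Fin.≟ y)) λ none →
    let hit = λ y → decidable-stable (Fin.any? λ x → f x Fin.≟ y) λ ¬hit →
                none (y , λ x eq → ¬hit (x , eq)) in
    Fin.<⇒notInjective {f = proj₁ ∘ hit} m<n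
      λ {y} {z} eq → trans (sym (proj₂ (hit y))) (trans (cong f eq) (proj₂ (hit z)))

another : ∀ {k} → 2 ≤ k → (i : Fin k) → ∃[ j ] j ≢ i
another (s≤s (s≤s _)) zero    = suc zero , λ ()
another (s≤s (s≤s _)) (suc i) = zero , λ ()

module StableColouring {k m n : ℕ} (2≤k : 2 ≤ k) (G : Graph m) (G′ : Graph n) (q : ℕ)
  (stable : ∀ u v → SameColour k q (W k q G u) (W k q G′ v) →
            SameColour k (suc q) (W k (suc q) G u) (W k (suc q) G′ v)) where

  _~_ : Tuple m k → Tuple n k → Set
  u ~ v = SameColour k q (W k q G u) (W k q G′ v)

  ~-isoType : ∀ {u v} → u ~ v → SameIsoType (m , G , u) (n , G′ , v)
  ~-isoType = go q
    where
    go : ∀ r {u v} → SameColour k r (W k r G u) (W k r G′ v) → SameIsoType (m , G , u) (n , G′ , v)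
    go zero    same = same
    go (suc r) same = go r (proj₁ same)

  ~-local : ∀ {u v} → u ~ v → ∀ i j →
            (Vec.lookup u i ≡ Vec.lookup u j ⇔ Vec.lookup v i ≡ Vec.lookup v j) ×
            adj G (Vec.lookup u i) (Vec.lookup u j) ≡ adj G′ (Vec.lookup v i) (Vec.lookup v j)
  ~-local u~v i j = let eqs , adjs = ~-isoType u~v i j in eqs , T-⇔⇒≡ adjs

  -- Stability lifts equal colours to the next round, whose set component offers one `b` that serves
  -- all `k` substitutions at once; hence the extra pebble.
  ~-forth : ∀ {u v} → u ~ v → ∀ a → ∃[ b ] ∀ i → (u [ i ]≔ a) ~ (v [ i ]≔ b)
  ~-forth {u} {v} u~v a =
    let b , same = proj₁ (sameSet⁻ (VecEq.≋-setoid (colourSetoid k q) k) (proj₂ (stable u v u~v))) a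
    in b , Pointwise.tabulate⁻ same

  ~-back : ∀ {u v} → u ~ v → ∀ b → ∃[ a ] ∀ i → (u [ i ]≔ a) ~ (v [ i ]≔ b)
  ~-back {u} {v} u~v b =
    let a , same = proj₂ (sameSet⁻ (VecEq.≋-setoid (colourSetoid k q) k) (proj₂ (stable u v u~v))) b
    in a , Pointwise.tabulate⁻ same

  slots : Tuple m k → Tuple n k → Fin k → Fin m × Fin n
  slots u v i = Vec.lookup u i , Vec.lookup v i

  -- k of the k + 1 pebbled pairs are read off two tuples of equal colour; (a , b) is
  -- the pair that the refinement step substitutes into them.
  record Board (p : List (Fin m × Fin n)) : Set where
    field
      u        : Tuple m k
      v        : Tuple n k
      a        : Fin m
      b        : Fin n
      u~v      : u ~ v
      u[a]~v[b] : ∀ i → (u [ i ]≔ a) ~ (v [ i ]≔ b)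
      onBoard  : ∀ {x} → x ∈ p → ∃[ s ] x ≡ ((a , b) F.∷ slots u v) s

    -- Put `(a , b)` into a slot other than `i`, so that both pairs appear in one pair of tuples;
    -- this takes `2 ≤ k`.
    a-local : ∀ i → (a ≡ Vec.lookup u i ⇔ b ≡ Vec.lookup v i) ×
                    adj G a (Vec.lookup u i) ≡ adj G′ b (Vec.lookup v i)
    a-local i with j , j≢i ← another 2≤k i
      with l ← ~-local (u[a]~v[b] j) j i
      rewrite Vec.lookup∘updateAt j {λ _ → a} u | Vec.lookup∘updateAt j {λ _ → b} v
            | Vec.lookup∘updateAt′ i j {λ _ → a} (j≢i ∘ sym) u
            | Vec.lookup∘updateAt′ i j {λ _ → b} (j≢i ∘ sym) v = l

    board-local : ∀ s t → let x = ((a , b) F.∷ slots u v) s ; y = ((a , b) F.∷ slots u v) t in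
                  (proj₁ x ≡ proj₁ y ⇔ proj₂ x ≡ proj₂ y) ×
                  adj G (proj₁ x) (proj₁ y) ≡ adj G′ (proj₂ x) (proj₂ y)
    board-local zero    zero    =
      mk⇔ (λ _ → refl) (λ _ → refl) , trans (loopless G a) (sym (loopless G′ b))
    board-local zero    (suc j) = a-local j
    board-local (suc i) zero    = let eqs , adjs = a-local i in
      mk⇔ (sym ∘ to eqs ∘ sym) (sym ∘ from eqs ∘ sym) ,
      trans (adj-sym G _ a) (trans adjs (adj-sym G′ b _))
    board-local (suc i) (suc j) = ~-local u~v i j

    -- At most `k` of the `k + 1` slots are in use. If slot `zero` is idle, `(a , b)` is dropped; if
    -- `suc i` is, `(a , b)` is substituted there, and `u[a]~v[b] i` gives the equal colours.
    free : length p ≤ k → ∃₂ λ u v → u ~ v × (∀ {x} → x ∈ p → ∃[ i ] x ≡ slots u v i)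
    free l≤k with missed (s≤s l≤k) (λ i → proj₁ (onBoard (∈.∈-lookup {xs = p} i)))
    ... | s , unused = vacate s λ x∈ →
      let i = index x∈ ; t , eq = onBoard (∈.∈-lookup {xs = p} i) in
      t , unused i , trans (Any.lookup-index x∈) eq
      where
      vacate : ∀ s → (∀ {x} → x ∈ p → ∃[ t ] t ≢ s × x ≡ ((a , b) F.∷ slots u v) t) →
               ∃₂ λ u v → u ~ v × (∀ {x} → x ∈ p → ∃[ i ] x ≡ slots u v i)
      vacate zero on = u , v , u~v , λ x∈ → on-tuples (on x∈)
        where
        on-tuples : ∀ {x} → (∃[ t ] t ≢ zero × x ≡ ((a , b) F.∷ slots u v) t) →
                    ∃[ i ] x ≡ slots u v i
        on-tuples (zero  , 0≢0 , _)  = contradiction refl 0≢0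
        on-tuples (suc i , _   , eq) = i , eq
      vacate (suc i) on = u [ i ]≔ a , v [ i ]≔ b , u[a]~v[b] i , λ x∈ → on-tuples (on x∈)
        where
        on-tuples : ∀ {x} → (∃[ t ] t ≢ suc i × x ≡ ((a , b) F.∷ slots u v) t) →
                    ∃[ j ] x ≡ slots (u [ i ]≔ a) (v [ i ]≔ b) j
        on-tuples (zero , _ , eq) = i , trans eq
          (sym (cong₂ _,_ (Vec.lookup∘updateAt i u) (Vec.lookup∘updateAt i v)))
        on-tuples (suc j , j≢i , eq) = j , trans eq
          (sym (cong₂ _,_ (Vec.lookup∘updateAt′ j i (j≢i ∘ cong suc) u)
                          (Vec.lookup∘updateAt′ j i (j≢i ∘ cong suc) v)))

  place-pair : ∀ {p u v a b} → u ~ v → (∀ i → (u [ i ]≔ a) ~ (v [ i ]≔ b)) →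
               (∀ {x} → x ∈ p → ∃[ i ] x ≡ slots u v i) → Board ((a , b) ∷ p)
  place-pair u~v sub on = record
    { u~v = u~v ; u[a]~v[b] = sub
    ; onBoard = λ { (here eq) → zero , eq ; (there x∈) → let i , eq = on x∈ in suc i , eq } }

  game : ∀ {u v} → u ~ v → Fin m → Game G G′ k
  game u₀~v₀ a₀ = record
    { Survives = Board
    -- A board always carries `k + 1` pairs; before the first move all of them are fillers.
    ; start    = let b₀ , sub = ~-forth u₀~v₀ a₀ in
                 record { u~v = u₀~v₀ ; u[a]~v[b] = sub ; onBoard = λ () }
    ; local    = λ B x∈ y∈ → pair-local B (Board.onBoard B x∈) (Board.onBoard B y∈)
    ; weaken   = λ q⊆p B → record
                 { u~v = Board.u~v B ; u[a]~v[b] = Board.u[a]~v[b] B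
                 ; onBoard = Board.onBoard B ∘ q⊆p }
    ; forth    = λ B l≤k a → let u , v , u~v , on = Board.free B l≤k ; b , sub = ~-forth u~v a in
                 b , place-pair u~v sub on
    ; back     = λ B l≤k b → let u , v , u~v , on = Board.free B l≤k ; a , sub = ~-back u~v b in
                 a , place-pair u~v sub on
    }
    where
    pair-local : ∀ {p a b c d} (B : Board p) →
                 let slot = (Board.a B , Board.b B) F.∷ slots (Board.u B) (Board.v B) in
                 (∃[ s ] (a , b) ≡ slot s) → (∃[ t ] (c , d) ≡ slot t) →
                 (a ≡ c ⇔ b ≡ d) × adj G a c ≡ adj G′ b d
    pair-local B (s , refl) (t , refl) = Board.board-local B s t

-- Decidability and the existence of WL(n)

record Listing (A : Set) : Set where
  field
    elements : List A
    complete : ∀ a → a ∈ elements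

module _ {A : Set} (L : Listing A) {P : A → Set} (P? : ∀ a → Dec (P a)) where

  open Listing L

  anyListed? : Dec (∃ P)
  anyListed? = map′ Any.satisfied (λ (a , Pa) → lose (complete a) Pa) (Any.any? P? elements)

  allListed? : Dec (∀ a → P a)
  allListed? = map′ (λ all a → All.lookup all (complete a)) (λ f → All.universal f elements)
                    (All.all? P? elements)

listing-Bool : Listing Bool
listing-Bool = record
  { elements = true ∷ false ∷ []
  ; complete = λ { true → here refl ; false → there (here refl) } }

listing-Fin : ∀ n → Listing (Fin n)
listing-Fin n = record { elements = allFin n ; complete = ∈.∈-allFin }

listing-× : ∀ {A B} → Listing A → Listing B → Listing (A × B)
listing-× L M = record
  { elements = cartesianProductWith _,_ (Listing.elements L) (Listing.elements M)
  ; complete = λ (a , b) →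
      ∈.∈-cartesianProductWith⁺ _,_ (Listing.complete L a) (Listing.complete M b) }

listing-⊎ : ∀ {A B} → Listing A → Listing B → Listing (A ⊎ B)
listing-⊎ L M = record
  { elements = map inj₁ (Listing.elements L) ++ map inj₂ (Listing.elements M)
  ; complete = λ { (inj₁ a) → ∈.∈-++⁺ˡ (∈.∈-map⁺ inj₁ (Listing.complete L a))
                 ; (inj₂ b) → ∈.∈-++⁺ʳ _ (∈.∈-map⁺ inj₂ (Listing.complete M b)) } }

listing-Vec : ∀ {A} → Listing A → ∀ n → Listing (Vec A n)
listing-Vec {A} L n = record { elements = vectors n ; complete = complete-vectors }
  where
  vectors : ∀ n → List (Vec A n)
  vectors zero    = [] ∷ []
  vectors (suc n) = cartesianProductWith _∷_ (Listing.elements L) (vectors n)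

  complete-vectors : ∀ {n} (v : Vec A n) → v ∈ vectors n
  complete-vectors []      = here refl
  complete-vectors (a ∷ v) =
    ∈.∈-cartesianProductWith⁺ _∷_ (Listing.complete L a) (complete-vectors v)

module _ {A : Set} {P Q : A → Set} (P? : ∀ a → Dec (P a)) (Q? : ∀ a → Dec (Q a))
         (P⊆Q : ∀ {a} → P a → Q a) where

  filter-mono-length : ∀ xs → length (filter P? xs) ≤ length (filter Q? xs)
  filter-mono-length [] = z≤n
  filter-mono-length (x ∷ xs) with P? x | Q? x
  ... | yes p | yes q = s≤s (filter-mono-length xs)
  ... | yes p | no ¬q = contradiction (P⊆Q p) ¬q
  ... | no ¬p | yes q = ℕ.m≤n⇒m≤1+n (filter-mono-length xs)
  ... | no ¬p | no ¬q = filter-mono-length xs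

  filter-strict-length : ∀ {x} xs → x ∈ xs → Q x → ¬ P x →
                         length (filter P? xs) < length (filter Q? xs)
  filter-strict-length (x ∷ xs) (here refl) q ¬p with P? x | Q? x
  ... | yes p | _     = contradiction p ¬p
  ... | no  _ | yes _ = s≤s (filter-mono-length xs)
  ... | no  _ | no ¬q = contradiction q ¬q
  filter-strict-length (x ∷ xs) (there x∈) q ¬p with P? x | Q? x
  ... | yes p  | yes q′ = s≤s (filter-strict-length xs x∈ q ¬p)
  ... | yes p  | no ¬q′ = contradiction (P⊆Q p) ¬q′
  ... | no ¬p′ | yes q′ = ℕ.m≤n⇒m≤1+n (filter-strict-length xs x∈ q ¬p)
  ... | no ¬p′ | no ¬q′ = filter-strict-length xs x∈ q ¬p

-- While some element is lost, the number of listed elements satisfying `P r` drops. With `A` the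
-- pairs of tuples, this makes the refinement stop.
decreasing⇒stationary : ∀ {A : Set} → Listing A → {P : ℕ → A → Set} →
                        (∀ r a → Dec (P r a)) → (∀ r {a} → P (suc r) a → P r a) →
                        ∃[ q ] ∀ a → P q a → P (suc q) a
decreasing⇒stationary L {P} P? shrinks = search 0 (ℕ.n<1+n _)
  where
  open Listing L
  size : ℕ → ℕ
  size r = length (filter (P? r) elements)

  search : ∀ {fuel} r → size r < fuel → ∃[ q ] ∀ a → P q a → P (suc q) a
  search {suc fuel} r size< with anyListed? L (λ a → P? r a ×-dec ¬? (P? (suc r) a))
  ... | no none = r , λ a Pra → decidable-stable (P? (suc r) a) λ ¬P → none (a , Pra , ¬P)
  ... | yes (a , Pra , ¬P) = search (suc r) (ℕ.<-≤-trans
    (filter-strict-length (P? (suc r)) (P? r) (shrinks r) elements (complete a) Pra ¬P)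
    (s≤s⁻¹ size<))

module _ {P : ℕ → Set} (P? : ∀ n → Dec (P n)) where

  least : ∃ P → ∃ (IsLeast P)
  least (n , Pn) = search n Pn
    where
    search : ∀ n → P n → ∃ (IsLeast P)
    search = <-rec _ λ n smaller Pn → case ℕ.anyUpTo? P? n of λ where
      (yes (m , m<n , Pm)) → smaller m<n Pm
      (no none)            → n , Pn , λ x Px → ℕ.≮⇒≥ λ x<n → none (x , x<n , Px)

  isLeast? : ∀ m → Dec (IsLeast P m)
  isLeast? m = P? m ×-dec
    map′ (λ none x Px → ℕ.≮⇒≥ λ x<m → none x<m Px)
         (λ lower {x} x<m Px → ℕ.<⇒≱ x<m (lower x Px))
         (ℕ.allUpTo? (λ x → ¬? (P? x)) m)

  greatest : ∀ bound → (∀ x → P x → x ≤ bound) → ∃ P → ∃ (IsGreatest P)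
  greatest zero upper (x , Px) with upper x Px
  ... | z≤n = zero , Px , upper
  greatest (suc bound) upper nonempty with P? (suc bound)
  ... | yes P-bound = suc bound , P-bound , upper
  ... | no ¬P-bound = greatest bound
    (λ x Px → s≤s⁻¹ (ℕ.≤∧≢⇒< (upper x Px) λ { refl → ¬P-bound Px })) nonempty

-- Isomorphism invariance and the output of the algorithm

module _ {m n : ℕ} {G : Graph m} {G′ : Graph n} (iso : G ≅ G′) where

  open _≅_ iso
  open Inverse bijection using () renaming (to to β; from to β⁻¹; strictlyInverseˡ to β∘β⁻¹)

  W-invariant : ∀ {k} r (u : Tuple m k) → SameColour k r (W k r G u) (W k r G′ (Vec.map β u))
  W-invariant zero u i j
    rewrite Vec.lookup-map i β u | Vec.lookup-map j β u =
    mk⇔ (cong β) (Injection.injective (↔⇒↣ bijection)) , preserves _ _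
  W-invariant {k} (suc r) u = W-invariant r u ,
    sameSet⁺ (VecEq.≋-setoid (colourSetoid k r) k)
      (λ w → β w , same w)
      (λ w′ → β⁻¹ w′ , subst (Substituted (β⁻¹ w′)) (β∘β⁻¹ w′) (same (β⁻¹ w′)))
    where
    Substituted : Fin m → Fin n → Set
    Substituted w w′ = Pointwise.Pointwise (SameColour k r)
      (tabulate λ i → W k r G (u [ i ]≔ w)) (tabulate λ i → W k r G′ (Vec.map β u [ i ]≔ w′))

    same : ∀ w → Substituted w (β w)
    same w = Pointwise.tabulate⁺ λ i →
      subst (λ x → SameColour k r (W k r G (u [ i ]≔ w)) (W k r G′ x))
        (Vec.map-[]≔ β u i) (W-invariant r (u [ i ]≔ w))

  ≅⇒decides : ∀ {k} r → IsomorphismTest.DecidesIsomorphicAfter k G G′ r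
  ≅⇒decides {k} r = sameSet⁺ (colourSetoid k r) (λ u → β u , same u)
    λ v → β⁻¹ v , subst (λ x → SameColour k r _ (W k r G′ (replicate k x))) (β∘β⁻¹ v) (same (β⁻¹ v))
    where
    same : ∀ u → SameColour k r (W k r G (replicate k u)) (W k r G′ (replicate k (β u)))
    same u = subst (λ x → SameColour k r (W k r G (replicate k u)) (W k r G′ x))
      (Vec.map-replicate β u k) (W-invariant r (replicate k u))

module Test {m n : ℕ} (k : ℕ) (G : Graph m) (G′ : Graph n) where

  open IsomorphismTest k G G′ hiding (RightOutput)

  listing-Tuples : Listing Tuples
  listing-Tuples = listing-⊎ (listing-Vec (listing-Fin m) k) (listing-Vec (listing-Fin n) k)

  Π? : ∀ r s t → Dec (Π r s t)
  Π? r s t = sameColour? k r ([ W k r G , W k r G′ ]′ s) ([ W k r G , W k r G′ ]′ t)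

  Π-refines : ∀ r s t → Π (suc r) s t → Π r s t
  Π-refines r (inj₁ u) (inj₁ v) = proj₁
  Π-refines r (inj₁ u) (inj₂ v) = proj₁
  Π-refines r (inj₂ u) (inj₁ v) = proj₁
  Π-refines r (inj₂ u) (inj₂ v) = proj₁

  stable? : ∀ r → Dec (Stable r)
  stable? zero    = no λ ()
  stable? (suc q) = map′ (λ same → q , refl , same) (λ { (_ , refl , same) → same })
    (allListed? listing-Tuples λ s → allListed? listing-Tuples λ t → Π? (suc q) s t ⇔? Π? q s t)

  stops : ∃ StopsAfter
  stops = least stable? (suc q , q , refl , λ s t → mk⇔ (Π-refines q s t) (stationary (s , t)))
    where
    chain = decreasing⇒stationary (listing-× listing-Tuples listing-Tuples) {λ r (s , t) → Π r s t}
              (λ r (s , t) → Π? r s t) (λ r {st} → Π-refines r (proj₁ st) (proj₂ st))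
    q = proj₁ chain
    stationary = proj₂ chain

  decides? : ∀ r → Dec (DecidesIsomorphicAfter r)
  decides? r = sameSet? (colourSetoid k r) (sameColour? k r)
    (diagonalColours r G) (diagonalColours r G′)

  stops-unique : ∀ {r r′} → StopsAfter r → StopsAfter r′ → r ≡ r′
  stops-unique (stable , low) (stable′ , low′) = ℕ.≤-antisym (low _ stable′) (low′ _ stable)

  -- For non-isomorphic graphs the right output is a negative verdict, and the stopping round is
  -- unique, so its verdict settles the matter.
  rightOutput? : ¬ G ≅ G′ → Dec (RightOutput k G G′)
  rightOutput? ≇ = judge stops
    where
    judge : ∃ StopsAfter → Dec (RightOutput k G G′)
    judge (r , stop) = map′
      (λ ¬decides → r , stop , mk⇔ (⊥-elim ∘ ¬decides) (⊥-elim ∘ ≇))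
      (λ (r′ , stop′ , right) →
        ≇ ∘ to right ∘ subst DecidesIsomorphicAfter (stops-unique stop stop′))
      (¬? (decides? r))

module _ {n k : ℕ} (2≤k : 2 ≤ k) (1≤n : 1 ≤ n) (n≤2k : n ≤ k + k) (G G′ : Graph n) where

  open IsomorphismTest k G G′ hiding (RightOutput)
  open Test k G G′

  -- One pair of equally coloured diagonal tuples starts the game; its colours agree in round `q` as
  -- well, where stability applies.
  stable-decides⇒≅ : ∀ r → Stable r → DecidesIsomorphicAfter r → G ≅ G′
  stable-decides⇒≅ _ (q , refl , same) decides =
    game⇒≅ 1≤n n≤2k (StableColouring.game 2≤k G G′ q
      (λ u v → from (same (inj₁ u) (inj₂ v))) (proj₁ (proj₂ twin-diagonal)) a)
    where
    a : Fin n
    a = fromℕ< 1≤n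
    twin-diagonal = proj₁ (sameSet⁻ (colourSetoid k (suc q)) decides) a

  rightOutput : RightOutput k G G′
  rightOutput = let r , stop = stops in
    r , stop , mk⇔ (stable-decides⇒≅ r (proj₁ stop)) (λ iso → ≅⇒decides iso r)

  ≅? : Dec (G ≅ G′)
  ≅? = let r , stop = stops in
    map′ (stable-decides⇒≅ r (proj₁ stop)) (λ iso → ≅⇒decides iso r) (decides? r)

infix 4 _≐_
-- A graph rebuilt from its matrix has the original adjacency only pointwise, so all notions are
-- transported along this relation rather than along `≡`.
_≐_ : ∀ {n} → Graph n → Graph n → Set
G ≐ H = ∀ u v → adj G u v ≡ adj H u v

≐-sym : ∀ {n} {G H : Graph n} → G ≐ H → H ≐ G
≐-sym eq u v = sym (eq u v)

≐⇒≅ : ∀ {n} {G H : Graph n} → G ≐ H → G ≅ H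
≐⇒≅ eq = injection⇒≅ id id λ a c _ → eq a c

≅-trans : ∀ {l m n} {G : Graph l} {H : Graph m} {I : Graph n} → G ≅ H → H ≅ I → G ≅ I
≅-trans p q = record
  { bijection = ↔-trans (_≅_.bijection p) (_≅_.bijection q)
  ; preserves = λ u v → mk⇔ (to (_≅_.preserves q _ _) ∘ to (_≅_.preserves p u v))
                            (from (_≅_.preserves p u v) ∘ from (_≅_.preserves q _ _)) }

W-cong : ∀ {n k} {G H : Graph n} → G ≐ H → ∀ r (u : Tuple n k) →
         SameColour k r (W k r G u) (W k r H u)
W-cong {k = k} {G} {H} eq r u = subst (λ x → SameColour k r (W k r G u) (W k r H x))
  (Vec.map-id u) (W-invariant (≐⇒≅ eq) r u)

≅-resp : ∀ {n} {G G′ H H′ : Graph n} → G ≐ H → G′ ≐ H′ → G ≅ G′ → H ≅ H′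
≅-resp {G = G} {H = H} G≐H G′≐H′ iso =
  ≅-trans (≐⇒≅ (≐-sym {G = G} {H} G≐H)) (≅-trans iso (≐⇒≅ G′≐H′))

module _ {k n : ℕ} where

  open IsomorphismTest k using (Π; Stable; DecidesIsomorphicAfter)

  module Transfer {G G′ H H′ : Graph n} (G≐H : G ≐ H) (G′≐H′ : G′ ≐ H′) where

    module _ (r : ℕ) where

      private
        module S = Setoid (colourSetoid k r)

        conjugate : ∀ {w x y z} → w S.≈ x → y S.≈ z → w S.≈ y → x S.≈ z
        conjugate {w} {x} {y} {z} wx yz wy =
          S.trans {x} {w} {z} (S.sym {w} {x} wx) (S.trans {w} {y} {z} wy yz)

      Π-resp : ∀ s t → Π G G′ r s t → Π H H′ r s t
      Π-resp (inj₁ u) (inj₁ v) = conjugate (W-cong G≐H r u) (W-cong G≐H r v)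
      Π-resp (inj₁ u) (inj₂ v) = conjugate (W-cong G≐H r u) (W-cong G′≐H′ r v)
      Π-resp (inj₂ u) (inj₁ v) = conjugate (W-cong G′≐H′ r u) (W-cong G≐H r v)
      Π-resp (inj₂ u) (inj₂ v) = conjugate (W-cong G′≐H′ r u) (W-cong G′≐H′ r v)

    decides-resp : ∀ r → DecidesIsomorphicAfter G G′ r → DecidesIsomorphicAfter H H′ r
    decides-resp r decides =
      S.trans (≅⇒decides (≐⇒≅ (≐-sym {G = G} {H} G≐H)) r)
        (S.trans decides (≅⇒decides (≐⇒≅ G′≐H′) r))
      where module S = Setoid (finiteSetSetoid (colourSetoid k r))

  rightOutput-resp : ∀ {G G′ H H′ : Graph n} → G ≐ H → G′ ≐ H′ →
                     RightOutput k G G′ → RightOutput k H H′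
  rightOutput-resp {G} {G′} {H} {H′} G≐H G′≐H′ (r , (stable , low) , right) = r
    -- Minimality of `r` carries over by pulling stable rounds for `H`, `H′` back to `G`, `G′`.
    , (stable-resp G≐H G′≐H′ H≐G H′≐G′ stable , λ q s → low q (stable-resp H≐G H′≐G′ G≐H G′≐H′ s))
    , mk⇔ (≅-resp G≐H G′≐H′ ∘ to right ∘ Transfer.decides-resp H≐G H′≐G′ r)
          (Transfer.decides-resp G≐H G′≐H′ r ∘ from right ∘ ≅-resp H≐G H′≐G′)
    where
    H≐G : H ≐ G
    H≐G = ≐-sym {G = G} {H} G≐H
    H′≐G′ : H′ ≐ G′
    H′≐G′ = ≐-sym {G = G′} {H′} G′≐H′

    stable-resp : ∀ {G G′ H H′ : Graph n} → G ≐ H → G′ ≐ H′ → H ≐ G → H′ ≐ G′ →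
                  ∀ {r} → Stable G G′ r → Stable H H′ r
    stable-resp p p′ p⁻¹ p′⁻¹ {r} (q , eq , same) = q , eq , λ s t → mk⇔
      (Transfer.Π-resp p p′ q s t ∘ to (same s t) ∘ Transfer.Π-resp p⁻¹ p′⁻¹ r s t)
      (Transfer.Π-resp p p′ r s t ∘ from (same s t) ∘ Transfer.Π-resp p⁻¹ p′⁻¹ q s t)

optimum-resp : ∀ {n d} {G G′ H H′ : Graph n} → G ≐ H → G′ ≐ H′ →
               IsOptimumDimension G G′ d → IsOptimumDimension H H′ d
optimum-resp {G = G} {G′} {H} {H′} G≐H G′≐H′ ((1≤d , right) , low) =
  (1≤d , rightOutput-resp G≐H G′≐H′ right) , λ x (1≤x , rightₓ) →
  low x (1≤x , rightOutput-resp (≐-sym {G = G} {H} G≐H) (≐-sym {G = G′} {H′} G′≐H′) rightₓ)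

-- Enumeration of graphs and the maximum

Matrix : ℕ → Set
Matrix n = Vec (Vec Bool n) n

-- Clearing the diagonal and conjoining each entry with its transpose turns every matrix into a
-- graph, so the enumeration needs no validity test.
fromMatrix : ∀ {n} → Matrix n → Graph n
fromMatrix {n} M = record { adj = adj′ ; adj-sym = adj′-sym ; loopless = adj′-irrefl }
  where
  entry : Fin n → Fin n → Bool
  entry u v = Vec.lookup (Vec.lookup M u) v

  adj′ : Fin n → Fin n → Bool
  adj′ u v = not (does (u Fin.≟ v)) ∧ (entry u v ∧ entry v u)

  adj′-sym : ∀ u v → adj′ u v ≡ adj′ v u
  adj′-sym u v = cong₂ (λ b c → not b ∧ c)
    (does-⇔ (mk⇔ sym sym) (u Fin.≟ v) (v Fin.≟ u)) (Bool.∧-comm (entry u v) (entry v u))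

  adj′-irrefl : ∀ v → adj′ v v ≡ false
  adj′-irrefl v rewrite dec-true (v Fin.≟ v) refl = refl

toMatrix : ∀ {n} → Graph n → Matrix n
toMatrix G = tabulate λ u → tabulate (adj G u)

fromMatrix∘toMatrix : ∀ {n} (G : Graph n) → fromMatrix (toMatrix G) ≐ G
fromMatrix∘toMatrix G u v
  rewrite Vec.lookup∘tabulate (λ u → tabulate (adj G u)) u | Vec.lookup∘tabulate (adj G u) v
        | Vec.lookup∘tabulate (λ u → tabulate (adj G u)) v | Vec.lookup∘tabulate (adj G v) u
        | adj-sym G v u | Bool.∧-idem (adj G u v)
  with u Fin.≟ v
... | yes refl = sym (loopless G u)
... | no  _    = refl

complete empty : ∀ n → Graph n
complete n = fromMatrix (replicate n (replicate n true))
empty    n = fromMatrix (replicate n (replicate n false))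

-- This makes the set whose maximum is `WL(n)` nonempty.
empty≇complete : ∀ {n} → 2 ≤ n → ¬ empty n ≅ complete n
empty≇complete {suc (suc n)} (s≤s (s≤s _)) iso = from (preserves zero (suc zero)) adjacent
  where
  open _≅_ iso
  β = Inverse.to bijection
  β-injective = Injection.injective (↔⇒↣ bijection)
  adjacent : Adjacent (complete (suc (suc n))) (β zero) (β (suc zero))
  adjacent
    rewrite dec-false (β zero Fin.≟ β (suc zero)) (λ eq → contradiction (β-injective eq) λ ())
          | Vec.lookup-replicate (β zero) (replicate (suc (suc n)) true)
          | Vec.lookup-replicate (β (suc zero)) (replicate (suc (suc n)) true)
          | Vec.lookup-replicate (β zero) true
          | Vec.lookup-replicate (β (suc zero)) true = _

Realised : ℕ → ℕ → Set
Realised n d = Σ (Graph n) λ G → Σ (Graph n) λ G′ → ¬ (G′ ≅ G) × IsOptimumDimension G G′ d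

module _ {n k : ℕ} (2≤k : 2 ≤ k) (2≤n : 2 ≤ n) (n≤2k : n ≤ k + k) where

  private
    1≤n : 1 ≤ n
    1≤n = ℕ.<⇒≤ 2≤n

  dimension? : ∀ {G G′ : Graph n} → ¬ G ≅ G′ → ∀ d → Dec (1 ≤ d × RightOutput d G G′)
  dimension? {G} {G′} ≇ d = (1 ℕ.≤? d) ×-dec Test.rightOutput? d G G′ ≇

  suitable : ∀ (G G′ : Graph n) → 1 ≤ k × RightOutput k G G′
  suitable G G′ = ℕ.<⇒≤ 2≤k , rightOutput 2≤k 1≤n n≤2k G G′

  nonisomorphicOptimum? : ∀ (G G′ : Graph n) d → Dec (¬ (G′ ≅ G) × IsOptimumDimension G G′ d)
  nonisomorphicOptimum? G G′ d = judge (≅? 2≤k 1≤n n≤2k G′ G)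
    where
    judge : Dec (G′ ≅ G) → Dec (¬ (G′ ≅ G) × IsOptimumDimension G G′ d)
    judge (yes iso) = no λ (≇ , _) → ≇ iso
    judge (no ≇)    = map′ (≇ ,_) proj₂ (isLeast? (dimension? (≇ ∘ ≅-sym)) d)

  -- It suffices to search matrices: a realising pair of graphs may be replaced by its matrices,
  -- since non-isomorphism and the optimum dimension transfer along `≐`.
  realised? : ∀ d → Dec (Realised n d)
  realised? d = map′
    (λ ((M , M′) , p) → fromMatrix M , fromMatrix M′ , p)
    (λ (G , G′ , ≇ , optimum) → (toMatrix G , toMatrix G′)
      , ≇ ∘ ≅-resp (fromMatrix∘toMatrix G′) (fromMatrix∘toMatrix G)
      , optimum-resp (≐-sym {G = fromMatrix (toMatrix G)} {G} (fromMatrix∘toMatrix G))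
                     (≐-sym {G = fromMatrix (toMatrix G′)} {G′} (fromMatrix∘toMatrix G′)) optimum)
    (anyListed? (listing-× matrices matrices) λ (M , M′) →
      nonisomorphicOptimum? (fromMatrix M) (fromMatrix M′) d)
    where
    matrices : Listing (Matrix n)
    matrices = listing-Vec (listing-Vec listing-Bool n) n

  realised⇒≤ : ∀ d → Realised n d → d ≤ k
  realised⇒≤ d (G , G′ , _ , _ , low) = low k (suitable G G′)

  WL-exists : ∃[ d ] IsWL n d × d ≤ k
  WL-exists =
    let G = complete n ; G′ = empty n ; ≇ = empty≇complete 2≤n
        d₀ , optimum = least (dimension? (≇ ∘ ≅-sym)) (k , suitable G G′)
        d , isWL = greatest realised? k realised⇒≤ (d₀ , G , G′ , ≇ , optimum)
    in d , isWL , realised⇒≤ d (proj₁ isWL)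

theorem7p6 : ∀ (n : ℕ) → 3 ≤ n → ∃[ d ] IsWL n d × 2 * d ≤ n + 1
theorem7p6 n 3≤n =
  -- `3 ≤ n` is what gives `2 ≤ ⌈ n /2⌉`.
  let d , isWL , d≤k = WL-exists {k = ⌈ n /2⌉} (ℕ.⌈n/2⌉-mono 3≤n) (ℕ.<⇒≤ 3≤n) n≤2k
  in d , isWL , (begin
    2 * d                         ≤⟨ ℕ.*-monoʳ-≤ 2 d≤k ⟩
    2 * ⌈ n /2⌉                   ≡⟨ cong (⌈ n /2⌉ +_) (ℕ.+-identityʳ ⌈ n /2⌉) ⟩
    -- `⌈ n /2⌉` is `⌊ suc n /2⌋` by definition.
    ⌊ suc n /2⌋ + ⌊ suc n /2⌋     ≤⟨ ℕ.+-monoʳ-≤ ⌊ suc n /2⌋ (ℕ.⌊n/2⌋≤⌈n/2⌉ (suc n)) ⟩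
    ⌊ suc n /2⌋ + ⌈ suc n /2⌉     ≡⟨ ℕ.⌊n/2⌋+⌈n/2⌉≡n (suc n) ⟩
    suc n                         ≡⟨ ℕ.+-comm 1 n ⟩
    n + 1                         ∎)
  where
  open ℕ.≤-Reasoning
  n≤2k : n ≤ ⌈ n /2⌉ + ⌈ n /2⌉
  n≤2k = begin
    n                             ≡⟨ ℕ.⌊n/2⌋+⌈n/2⌉≡n n ⟨
    ⌊ n /2⌋ + ⌈ n /2⌉             ≤⟨ ℕ.+-monoˡ-≤ ⌈ n /2⌉ (ℕ.⌊n/2⌋≤⌈n/2⌉ n) ⟩
    ⌈ n /2⌉ + ⌈ n /2⌉             ∎
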